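{- For every constant $\varepsilon\in(0,1)$ there is a constant $K=K(\varepsilon)$ such that for every even integer $n\ge 8/\varepsilon$ there is a deterministic online algorithm $\mathcal A$ for unweighted fully dynamic capacitated $2$-recoloring on $n$ vertices, using capacity $(1+\varepsilon)\frac n2$ for each of the two colors, that is $O(n\log n)$-competitive against an optimal offline algorithm using capacity $\frac n2$ for each color. That is, there is a number $\mu$ that does not depend on the request sequence (it may depend on $n$ and $\varepsilon$) such that for every request sequence $\sigma$, $$\mathcal A_\sigma\le K\, n\log n\cdot OPT_\sigma+\mu .$$
   Context: Unweighted fully dynamic capacitated $2$-recoloring. There is a fixed set $V$ of $n$ vertices, each of weight $1$, and an initial coloring $c_0:V\to\{1,2\}$ in which each color is used by at most $n/2$ vertices. A finite sequence $\sigma=(\sigma_1,\dots,\sigma_T)$ of requests, of arbitrary length, is revealed one at a time; each request $\sigma_t=(u_t,v_t)$ is a pair of distinct vertices. The graph formed by all requests need not be $2$-colorable. After each request $\sigma_t$ the algorithm must output a coloring $c_t:V\to\{1,2\}$ with $c_t(u_t)\ne c_t(v_t)$ (only the current request must be satisfied, not earlier ones), and the number of vertices of each color must not exceed the capacity at any time. Recoloring one vertex costs $1$, so the total cost is $\sum_{t=1}^T|\{v:c_t(v)\neq c_{t-1}(v)\}|$. A deterministic online algorithm determines $c_t$ from $c_0$ and $\sigma_1,\dots,\sigma_t$ only. $\mathcal A_\sigma$ denotes the total cost of $\mathcal A$ on $\sigma$, where $\mathcal A$ has capacity $(1+\varepsilon)\frac n2$ per color ($(1+\varepsilon)$-resource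 augmentation). $OPT_\sigma$ denotes the minimum total cost of an offline algorithm (which knows all of $\sigma$ in advance) that has capacity $B=\frac n2$ per color. -}

module Defs where

open import Data.Empty using (⊥)
open import Data.Fin using (Fin; _≟_)
open import Data.Integer using (+_)
open import Data.List using (List; []; _∷_; map; module Inits)
open import Data.List.Relation.Binary.Pointwise using (Pointwise)
open import Data.Nat as ℕ using (ℕ)
open import Data.Nat.DivMod using () renaming (_/_ to _/ℕ_)
open import Data.Product using (∃; ∃-syntax; _×_)
open import Data.Rational as ℚ using (ℚ; 0ℚ; 1ℚ)
open import Data.Sum using (_⊎_)
open import Data.Vec using (count; allFin)
open import Function.Bundles using (_⇔_)
open import Relation.Binary.PropositionalEquality using (_≡_; _≢_)
open import Relation.Nullary using (¬?)

-- Dedekind reals: L q means q < x, and U q means x < q.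
record ℝ : Set₁ where
  field
    L U         : ℚ → Set
    L-inhabited : ∃ L
    U-inhabited : ∃ U
    L-rounded   : ∀ q → L q ⇔ (∃[ r ] q ℚ.< r × L r)
    U-rounded   : ∀ q → U q ⇔ (∃[ r ] r ℚ.< q × U r)
    disjoint    : ∀ q → L q → U q → ⊥
    located     : ∀ {q r} → q ℚ.< r → L q ⊎ U r

open ℝ public using (L; U)

-- The constraint 0 < x < 1.
InUnitInterval : ℝ → Set
InUnitInterval x = L x 0ℚ × U x 1ℚ

-- For f continuous and nondecreasing, f x is the infimum of f r over the
-- rationals r > x, so  q ≤ f at x  says  q ≤ f x.  Only affine f are used.
infix 4 _≤_at_
_≤_at_ : ℚ → (ℚ → ℚ) → ℝ → Set
q ≤ f at x = ∀ r → U x r → q ℚ.≤ f r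

fromℕ : ℕ → ℚ
fromℕ k = + k ℚ./ 1

-- n ≥ 8 / ε, for ε > 0, written as 8 ≤ n ε.
_≥8/_ : ℕ → ℝ → Set
n ≥8/ ε = fromℕ 8 ≤ (λ x → fromℕ n ℚ.* x) at ε

Color : Set
Color = Fin 2

Coloring : ℕ → Set
Coloring n = Fin n → Color

record Request (n : ℕ) : Set where
  constructor request
  field
    u v      : Fin n
    distinct : u ≢ v

classSize : ∀ {n} → Coloring n → Color → ℕ
classSize {n} c i = count (λ w → c w ≟ i) (allFin n)

distance : ∀ {n} → Coloring n → Coloring n → ℕ
distance {n} c d = count (λ w → ¬? (d w ≟ c w)) (allFin n)

-- A capacity is given by the set of color class sizes it admits, because the
-- bound itself may be real.
Capacity : Set₁
Capacity = ℕ → Set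

-- For even n the natural-number quotient is exactly n/2.
half : ℕ → Capacity
half n k = k ℕ.≤ n /ℕ 2

-- k ≤ (1 + ε) n/2.
augmented : ℝ → ℕ → Capacity
augmented ε n k = fromℕ k ≤ (λ x → (1ℚ ℚ.+ x) ℚ.* (+ n ℚ./ 2)) at ε

Respects : ∀ {n} → Capacity → Coloring n → Set
Respects B c = ∀ i → B (classSize c i)

Satisfies : ∀ {n} → Request n → Coloring n → Set
Satisfies r c = c (Request.u r) ≢ c (Request.v r)

-- The list of colorings is c₁, …, c_T, one after each request.
Feasible : ∀ {n} → Capacity → List (Request n) → List (Coloring n) → Set
Feasible B = Pointwise (λ r c → Satisfies r c × Respects B c)

cost : ∀ {n} → Coloring n → List (Coloring n) → ℕ
cost c []       = 0
cost c (d ∷ ds) = distance c d ℕ.+ cost d ds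

IsOPT : ∀ {n} → Capacity → Coloring n → List (Request n) → ℕ → Set
IsOPT B c₀ σ m =
  (∃[ cs ] Feasible B σ cs × cost c₀ cs ≡ m) ×
  (∀ cs → Feasible B σ cs → m ℕ.≤ cost c₀ cs)

-- Maps c₀ and the requests seen so far to the current coloring; the value at
-- the empty list of requests is never used.
OnlineAlgorithm : ℕ → Set
OnlineAlgorithm n = Coloring n → List (Request n) → Coloring n

-- Inits.tail σ lists the nonempty prefixes of σ in order of length.
run : ∀ {n} → OnlineAlgorithm n → Coloring n → List (Request n) → List (Coloring n)
run A c₀ σ = map (A c₀) (Inits.tail σ)

{-# OPTIONS --safe #-}

-- The algorithm works in phases.  A phase ends when no perfectly balanced
-- coloring satisfies all its requests; then the offline algorithm must have
-- moved during the phase, so it suffices to pay O(n log n) per phase.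
--
-- Within a phase, the components formed by merging the two ends of violated
-- requests have forced relative colors.  A violated request is repaired by
-- flipping the smaller of the two components it joins, which costs O(n log n)
-- per phase in total.  Flipping m vertices increases each color class by at
-- most m, so the capacity is respected until a fraction of the vertices that
-- depends only on ε has been flipped; then the algorithm jumps, at cost at most
-- n, to a perfectly balanced coloring satisfying all requests of the phase.  The
-- jump is paid by the flips preceding it, up to a factor depending on ε.
module Submission where
open import Defs
open import Data.Bool using (Bool; not; _xor_; if_then_else_)
open import Data.Empty using (⊥; ⊥-elim)
open import Data.Fin using (Fin; zero; suc; opposite; _≟_)
import Data.Fin.Properties as Fin
open import Data.Fin.Subset using (Subset)
open import Data.Fin.Subset.Properties using (anySubset?)
open import Data.List using (List; []; _∷_; [_]; foldl; map; module Inits)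
open import Data.List.Properties using (map-∘)
open import Data.List.Relation.Binary.Pointwise using ([]; _∷_)
open import Data.List.Relation.Unary.All as All using (All; []; _∷_)
open import Data.Integer as ℤ using (+_; -[1+_])
import Data.Integer.Properties as ℤ
open import Data.Nat using (ℕ; zero; suc; z≤n; s≤s; _+_; _*_; _≤_; _<_; _≤?_)
open import Data.Nat.Divisibility using (_∣_)
open import Data.Nat.DivMod using (_/_; m/n*n≤m; m≡m%n+[m/n]*n; m%n<n)
open import Data.Nat.Properties hiding (_≟_)
open import Data.Nat.Logarithm using (⌊log₂_⌋; ⌊log₂⌋-mono-≤; ⌊log₂[2*b]⌋≡1+⌊log₂b⌋)
open import Data.Nat.Solver using (module +-*-Solver)
open import Data.Product using (Σ-syntax; ∃; ∃-syntax; _×_; _,_)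
open import Data.Rational as ℚ using (0ℚ; 1ℚ; mkℚ)
import Data.Rational.Properties as ℚ
import Data.Rational.Unnormalised as ℚᵘ
import Data.Rational.Unnormalised.Properties as ℚᵘ
open import Data.Sum using (_⊎_; inj₁; inj₂)
open import Data.Vec as Vec using (Vec; []; _∷_; count; allFin; sum; lookup; tabulate)
open import Data.Vec.Functional using (updateAt)
open import Data.Vec.Functional.Properties using (updateAt-updates; updateAt-minimal)
open import Data.Vec.Membership.Propositional using (_∈_)
open import Data.Vec.Membership.Propositional.Properties using (∈-allFin⁺)
open import Data.Vec.Properties using (count≤n; lookup∘tabulate)
open import Data.Vec.Relation.Unary.Any using (here; there)
open import Function using (_∘_; id)
open import Function.Bundles using (Equivalence)
open import Relation.Nullary using (Dec; yes; no; does; ¬_; ¬?)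
open import Relation.Nullary.Decidable using (map′; _×-dec_)
open import Relation.Unary using (Decidable)
open import Relation.Binary using (tri<; tri≈; tri>)
open import Relation.Binary.PropositionalEquality
  using (_≡_; _≢_; refl; sym; trans; cong; cong₂; subst; subst₂; module ≡-Reasoning)

-- Counting in vectors.

module _ {A : Set} {P Q R : A → Set} (P? : Decidable P) (Q? : Decidable Q) (R? : Decidable R) where

  count-⊎-≤ : (∀ x → P x → Q x ⊎ R x) →
              ∀ {m} (xs : Vec A m) → count P? xs ≤ count Q? xs + count R? xs
  count-⊎-≤ P⊆Q∪R [] = z≤n
  count-⊎-≤ P⊆Q∪R (x ∷ xs) with count-⊎-≤ P⊆Q∪R xs | P? x | Q? x | R? x
  ... | ih | no _  | no _   | no _   = ih
  ... | ih | no _  | no _   | yes _  = ≤-trans ih (+-monoʳ-≤ _ (n≤1+n _))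
  ... | ih | no _  | yes _  | no _   = m≤n⇒m≤1+n ih
  ... | ih | no _  | yes _  | yes _  = m≤n⇒m≤1+n (≤-trans ih (+-monoʳ-≤ _ (n≤1+n _)))
  ... | ih | yes _ | yes _  | no _   = s≤s ih
  ... | ih | yes _ | yes _  | yes _  = s≤s (≤-trans ih (+-monoʳ-≤ _ (n≤1+n _)))
  ... | ih | yes _ | no _   | yes _  = ≤-trans (s≤s ih) (≤-reflexive (sym (+-suc _ _)))
  ... | ih | yes p | no ¬q  | no ¬r  with P⊆Q∪R x p
  ...   | inj₁ q = ⊥-elim (¬q q)
  ...   | inj₂ r = ⊥-elim (¬r r)

  count-disjoint-≤ : (∀ x → P x → Q x → ⊥) → (∀ x → P x → R x) → (∀ x → Q x → R x) →
                     ∀ {m} (xs : Vec A m) → count P? xs + count Q? xs ≤ count R? xs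
  count-disjoint-≤ ¬PQ P⊆R Q⊆R [] = z≤n
  count-disjoint-≤ ¬PQ P⊆R Q⊆R (x ∷ xs)
    with count-disjoint-≤ ¬PQ P⊆R Q⊆R xs | P? x | Q? x | R? x
  ... | ih | yes p | yes q | _     = ⊥-elim (¬PQ x p q)
  ... | ih | yes p | _     | no ¬r = ⊥-elim (¬r (P⊆R x p))
  ... | ih | _     | yes q | no ¬r = ⊥-elim (¬r (Q⊆R x q))
  ... | ih | yes _ | no _  | yes _ = s≤s ih
  ... | ih | no _  | yes _ | yes _ = ≤-trans (≤-reflexive (+-suc _ _)) (s≤s ih)
  ... | ih | no _  | no _  | yes _ = m≤n⇒m≤1+n ih
  ... | ih | no _  | no _  | no _  = ih

module _ {A : Set} {P Q : A → Set} (P? : Decidable P) (Q? : Decidable Q) where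

  count-mono : (∀ x → P x → Q x) → ∀ {m} (xs : Vec A m) → count P? xs ≤ count Q? xs
  count-mono P⊆Q [] = z≤n
  count-mono P⊆Q (x ∷ xs) with count-mono P⊆Q xs | P? x | Q? x
  ... | ih | yes p | no ¬q = ⊥-elim (¬q (P⊆Q x p))
  ... | ih | yes _ | yes _ = s≤s ih
  ... | ih | no _  | yes _ = m≤n⇒m≤1+n ih
  ... | ih | no _  | no _  = ih

module _ {A : Set} {P : A → Set} (P? : Decidable P) where

  count>0 : ∀ {m x} {xs : Vec A m} → P x → x ∈ xs → 0 < count P? xs
  count>0 {xs = x ∷ _} px (here refl) with P? x
  ... | yes _ = s≤s z≤n
  ... | no ¬p = ⊥-elim (¬p px)
  count>0 {xs = x ∷ _} px (there x∈xs) with P? x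
  ... | yes _ = s≤s z≤n
  ... | no _  = count>0 px x∈xs

  count-none : (∀ x → ¬ P x) → ∀ {m} (xs : Vec A m) → count P? xs ≡ 0
  count-none ¬P [] = refl
  count-none ¬P (x ∷ xs) with P? x
  ... | yes p = ⊥-elim (¬P x p)
  ... | no _  = count-none ¬P xs

  -- A strict inequality of naturals is a gain of at least one, so each element of `P` adds one to
  -- the sum. In this way a growing potential pays for flips.
  sum+count-≤ : ∀ {f g : A → ℕ} → (∀ x → f x ≤ g x) → (∀ x → P x → f x < g x) →
                ∀ {m} (xs : Vec A m) → sum (Vec.map f xs) + count P? xs ≤ sum (Vec.map g xs)
  sum+count-≤ f≤g f<g [] = z≤n
  sum+count-≤ {f} f≤g f<g (x ∷ xs) with sum+count-≤ f≤g f<g xs | P? x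
  ... | ih | yes p = ≤-trans (≤-reflexive (trans (+-suc (f x + _) _) (cong suc (+-assoc (f x) _ _))))
                             (+-mono-≤ (f<g x p) ih)
  ... | ih | no _  = ≤-trans (≤-reflexive (+-assoc (f x) _ _)) (+-mono-≤ (f≤g x) ih)

sum-map-≤ : ∀ {A : Set} {f : A → ℕ} {k} → (∀ x → f x ≤ k) →
            ∀ {m} (xs : Vec A m) → sum (Vec.map f xs) ≤ m * k
sum-map-≤ f≤k []       = z≤n
sum-map-≤ f≤k (x ∷ xs) = +-mono-≤ (f≤k x) (sum-map-≤ f≤k xs)

count-≟-tabulate : ∀ {m n} (f : Fin m → Fin n) → (∀ {i j} → f i ≡ f j → i ≡ j) →
                   ∀ v → count (_≟ v) (tabulate f) ≤ 1
count-≟-tabulate {zero}  f inj v = z≤n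
count-≟-tabulate {suc m} f inj v with f zero ≟ v
... | no _     = count-≟-tabulate (f ∘ suc) (Fin.suc-injective ∘ inj) v
... | yes refl = s≤s (go (f ∘ suc) λ i e → Fin.0≢1+n (inj (sym e)))
  where
  go : ∀ {k} (g : Fin k → Fin _) → (∀ i → g i ≢ f zero) → count (_≟ f zero) (tabulate g) ≤ 0
  go {zero}  g g≢ = z≤n
  go {suc k} g g≢ with g zero ≟ f zero
  ... | yes e = ⊥-elim (g≢ zero e)
  ... | no _  = go (g ∘ suc) (g≢ ∘ suc)

-- Colorings, and the search for a balanced one.

module _ {n : ℕ} where

  distance≤n : (c d : Coloring n) → distance c d ≤ n
  distance≤n c d = count≤n (λ w → ¬? (d w ≟ c w)) (allFin n)

  0<distance⊎≗ : (c d : Coloring n) → 0 < distance c d ⊎ (∀ w → d w ≡ c w)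
  0<distance⊎≗ c d with Fin.all? (λ w → d w ≟ c w)
  ... | yes d≗c = inj₂ d≗c
  ... | no ¬d≗c with Fin.¬∀⟶∃¬ n _ (λ w → d w ≟ c w) ¬d≗c
  ...   | w , dw≢cw = inj₁ (count>0 _ dw≢cw (∈-allFin⁺ w))

  distance-within : ∀ {S : Fin n → Set} (S? : Decidable S) (c d : Coloring n) →
                    (∀ w → ¬ S w → d w ≡ c w) → distance c d ≤ count S? (allFin n)
  distance-within S? c d eq = count-mono (λ w → ¬? (d w ≟ c w)) S? inside (allFin n)
    where
    inside : ∀ w → d w ≢ c w → _
    inside w dw≢cw with S? w
    ... | yes s = s
    ... | no ¬s = ⊥-elim (dw≢cw (eq w ¬s))

  classSize-within : ∀ {S : Fin n → Set} (S? : Decidable S) (c d : Coloring n) →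
                     (∀ w → ¬ S w → d w ≡ c w) →
                     ∀ i → classSize d i ≤ classSize c i + count S? (allFin n)
  classSize-within S? c d eq i = count-⊎-≤ (λ w → d w ≟ i) (λ w → c w ≟ i) S? split (allFin n)
    where
    split : ∀ w → d w ≡ i → c w ≡ i ⊎ _
    split w dw≡i with S? w
    ... | yes s = inj₂ s
    ... | no ¬s = inj₁ (trans (sym (eq w ¬s)) dw≡i)

  Admissible : List (Request n) → Coloring n → Set
  Admissible E d = Respects (half n) d × All (λ r → Satisfies r d) E

  -- Colorings are functions and are known to be equal only pointwise, so their properties are
  -- transported by hand.
  Satisfies-resp : ∀ {c d : Coloring n} → (∀ w → d w ≡ c w) → ∀ {r} → Satisfies r c → Satisfies r d
  Satisfies-resp d≗c {r} cu≢cv du≡dv =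
    cu≢cv (trans (sym (d≗c (Request.u r))) (trans du≡dv (d≗c (Request.v r))))

  Admissible-resp : ∀ {c d : Coloring n} → (∀ w → d w ≡ c w) → ∀ {E} → Admissible E c → Admissible E d
  Admissible-resp d≗c (balanced , satisfied) =
    (λ i → ≤-trans (count-mono _ _ (λ w dw≡i → trans (sym (d≗c w)) dw≡i) (allFin n)) (balanced i)) ,
    All.map (λ {r} → Satisfies-resp d≗c {r}) satisfied

  decode : Subset n → Coloring n
  decode s w = if lookup s w then zero else suc zero

  encode : Coloring n → Subset n
  encode d = tabulate (λ w → does (d w ≟ zero))

  decode-encode : ∀ d w → decode (encode d) w ≡ d w
  decode-encode d w rewrite lookup∘tabulate (λ w → does (d w ≟ zero)) w with d w
  ... | zero     = refl
  ... | suc zero = refl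

  -- The search runs over bit vectors, of which there are finitely many; every coloring agrees
  -- pointwise with a decoded one.
  admissible? : ∀ E → Dec (∃ (Admissible E))
  admissible? E = map′ (λ (s , adm) → decode s , adm)
                       (λ (d , adm) → encode d , Admissible-resp (decode-encode d) adm)
                       (anySubset? λ s → Fin.all? (λ i → classSize (decode s) i ≤? n / 2)
                                         ×-dec All.all? (λ r → ¬? (decode s (Request.u r) ≟ decode s (Request.v r))) E)

-- Algebra of two colors.

-- On two colors, agree is the negation of addition modulo 2.
agree : Color → Color → Bool
agree p q = does (p ≟ q)

agree-opposite : ∀ p q → agree (opposite p) q ≡ not (agree p q)
agree-opposite zero       zero       = refl
agree-opposite zero       (suc zero) = refl
agree-opposite (suc zero) zero       = refl
agree-opposite (suc zero) (suc zero) = refl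

opposite-≢ : ∀ (p : Color) → opposite p ≢ p
opposite-≢ zero       ()
opposite-≢ (suc zero) ()

not-agree : ∀ p {q q′} → q ≢ q′ → not (agree p q) ≡ agree p q′
not-agree p {zero} {zero} q≢q′ = ⊥-elim (q≢q′ refl)
not-agree p {suc zero} {suc zero} q≢q′ = ⊥-elim (q≢q′ refl)
not-agree zero {zero} {suc zero} _ = refl
not-agree zero {suc zero} {zero} _ = refl
not-agree (suc zero) {zero} {suc zero} _ = refl
not-agree (suc zero) {suc zero} {zero} _ = refl

agree-injective : ∀ p {q q′} → agree p q ≡ agree p q′ → q ≡ q′
agree-injective zero       {zero}     {zero}     _ = refl
agree-injective zero       {suc zero} {suc zero} _ = refl
agree-injective (suc zero) {zero}     {zero}     _ = refl
agree-injective (suc zero) {zero}     {suc zero} ()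
agree-injective (suc zero) {suc zero} {suc zero} _ = refl

agree-xor : ∀ p q r → agree q r ≡ not (agree p q xor agree p r)
agree-xor zero       zero       zero       = refl
agree-xor zero       zero       (suc zero) = refl
agree-xor zero       (suc zero) zero       = refl
agree-xor zero       (suc zero) (suc zero) = refl
agree-xor (suc zero) zero       zero       = refl
agree-xor (suc zero) zero       (suc zero) = refl
agree-xor (suc zero) (suc zero) zero       = refl
agree-xor (suc zero) (suc zero) (suc zero) = refl

-- A reference color determines whether two others agree. After a jump this replaces the flipped
-- coloring by the new one as the coloring that components are aligned with.
agree-trans : ∀ p p′ {q q′ r r′} → agree p q ≡ agree p′ q′ → agree p r ≡ agree p′ r′ →
              agree q r ≡ agree q′ r′
agree-trans p p′ {q} {q′} {r} {r′} e f = begin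
  agree q r                          ≡⟨ agree-xor p q r ⟩
  not (agree p q xor agree p r)      ≡⟨ cong₂ (λ a b → not (a xor b)) e f ⟩
  not (agree p′ q′ xor agree p′ r′)  ≡⟨ agree-xor p′ q′ r′ ⟨
  agree q′ r′                        ∎
  where open ≡-Reasoning

-- The logarithmic potential of merging small components into large ones.

⌊log₂⌋-double : ∀ {m k} → 0 < m → m + m ≤ k → ⌊log₂ m ⌋ < ⌊log₂ k ⌋
⌊log₂⌋-double {m@(suc _)} {k} _ m+m≤k = begin
  1 + ⌊log₂ m ⌋    ≡⟨ ⌊log₂[2*b]⌋≡1+⌊log₂b⌋ m ⟨
  ⌊log₂ 2 * m ⌋    ≤⟨ ⌊log₂⌋-mono-≤ (≤-trans (≤-reflexive (cong (λ t → m + t) (+-identityʳ m))) m+m≤k) ⟩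
  ⌊log₂ k ⌋        ∎
  where open ≤-Reasoning

module _ {n : ℕ} where

  compSize : (Fin n → Fin n) → Fin n → ℕ
  compSize comp l = count (λ w → comp w ≟ l) (allFin n)

  -- Each vertex carries the number of doublings that lead from a singleton to the size of its
  -- component.
  potential : (Fin n → Fin n) → ℕ
  potential comp = sum (Vec.map (λ w → ⌊log₂ compSize comp (comp w) ⌋) (allFin n))

  potential-≤ : ∀ comp → potential comp ≤ n * ⌊log₂ n ⌋
  potential-≤ comp =
    sum-map-≤ (λ w → ⌊log₂⌋-mono-≤ (count≤n (λ w′ → comp w′ ≟ comp w) (allFin n))) (allFin n)

  relabel : Fin n → Fin n → (Fin n → Fin n) → Fin n → Fin n
  relabel a b comp w = if does (comp w ≟ a) then b else comp w

  relabel-≡ : ∀ {a b} comp {w} → comp w ≡ a → relabel a b comp w ≡ b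
  relabel-≡ {a} comp {w} e with comp w ≟ a
  ... | yes _ = refl
  ... | no ¬e = ⊥-elim (¬e e)

  relabel-≢ : ∀ {a b} comp {w} → comp w ≢ a → relabel a b comp w ≡ comp w
  relabel-≢ {a} comp {w} ¬e with comp w ≟ a
  ... | yes e = ⊥-elim (¬e e)
  ... | no _  = refl

  module _ (comp : Fin n → Fin n) {a b : Fin n} (a≢b : a ≢ b)
           (a≤b : compSize comp a ≤ compSize comp b) where

    private
      comp′ = relabel a b comp

    compSize-merged : compSize comp a + compSize comp b ≤ compSize comp′ b
    compSize-merged = count-disjoint-≤ _ _ _
      (λ w w∈a w∈b → a≢b (trans (sym w∈a) w∈b))
      (λ w → relabel-≡ comp)
      (λ w w∈b → trans (relabel-≢ comp (λ w∈a → a≢b (trans (sym w∈a) w∈b))) w∈b)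
      (allFin n)

    compSize-unmerged : ∀ {l} → l ≢ a → compSize comp l ≤ compSize comp′ l
    compSize-unmerged l≢a = count-mono _ _
      (λ w w∈l → trans (relabel-≢ comp (λ w∈a → l≢a (trans (sym w∈l) w∈a))) w∈l) (allFin n)

    -- The merged component contains both old ones, so it is at least twice as large as `a`, the
    -- smaller of the two.
    log-moved : ∀ w → comp w ≡ a → ⌊log₂ compSize comp (comp w) ⌋ < ⌊log₂ compSize comp′ (comp′ w) ⌋
    log-moved w refl = ⌊log₂⌋-double (count>0 (λ w′ → comp w′ ≟ comp w) refl (∈-allFin⁺ w)) (begin
      compSize comp a + compSize comp a     ≤⟨ +-monoʳ-≤ _ a≤b ⟩
      compSize comp a + compSize comp b     ≤⟨ compSize-merged ⟩
      compSize comp′ b                      ≡⟨ cong (compSize comp′) (relabel-≡ comp refl) ⟨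
      compSize comp′ (comp′ w)              ∎)
      where open ≤-Reasoning

    log-mono : ∀ w → ⌊log₂ compSize comp (comp w) ⌋ ≤ ⌊log₂ compSize comp′ (comp′ w) ⌋
    log-mono w with comp w ≟ a
    ... | yes e = <⇒≤ (subst (λ l → _ < ⌊log₂ compSize comp′ l ⌋) (relabel-≡ comp e) (log-moved w e))
    ... | no ¬e = ⌊log₂⌋-mono-≤ (compSize-unmerged ¬e)

    potential-relabel : potential comp + compSize comp a ≤ potential comp′
    potential-relabel = sum+count-≤ (λ w → comp w ≟ a) log-mono log-moved (allFin n)

-- Here `x` is the cost of one step and `t` that of the rest; `a` and `m` are potential and credit
-- before the step, `a′` and `m′` after it, and `c + w` is the remaining budget. Adding the
-- hypotheses cancels `m′ + a′`.
telescope : ∀ {x t a a′ m m′ c w} → x + a + m′ ≤ m + a′ → t + a′ ≤ m′ + c + w → x + t + a ≤ m + c + w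
telescope {x} {t} {a} {a′} {m} {m′} {c} {w} first rest = +-cancelʳ-≤ (m′ + a′) _ _ (begin
  x + t + a + (m′ + a′)    ≡⟨ solve 5 (λ x t a a′ m′ → x :+ t :+ a :+ (m′ :+ a′) := x :+ a :+ m′ :+ (t :+ a′)) refl x t a a′ m′ ⟩
  x + a + m′ + (t + a′)    ≤⟨ +-mono-≤ first rest ⟩
  m + a′ + (m′ + c + w)    ≡⟨ solve 5 (λ a′ m m′ c w → m :+ a′ :+ (m′ :+ c :+ w) := m :+ c :+ w :+ (m′ :+ a′)) refl a′ m m′ c w ⟩
  m + c + w + (m′ + a′)    ∎)
  where
  open ≤-Reasoning
  open +-*-Solver

-- The online algorithm.

-- seen lists the requests of the current phase, comp labels the components,
-- and moved counts the flips since the coloring was last perfectly balanced.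
record State (n : ℕ) : Set where
  field
    colors : Coloring n
    comp   : Fin n → Fin n
    moved  : ℕ
    seen   : List (Request n)

open State

module Algorithm {n : ℕ} (b : ℕ) (c₀ : Coloring n) where

  flip : Fin n → (Fin n → Fin n) → Coloring n → Coloring n
  flip l comp c w = if does (comp w ≟ l) then opposite (c w) else c w

  flip-∈ : ∀ {l} comp c {w} → comp w ≡ l → flip l comp c w ≡ opposite (c w)
  flip-∈ {l} comp c {w} e with comp w ≟ l
  ... | yes _ = refl
  ... | no ¬e = ⊥-elim (¬e e)

  flip-∉ : ∀ {l} comp c {w} → comp w ≢ l → flip l comp c w ≡ c w
  flip-∉ {l} comp c {w} ¬e with comp w ≟ l
  ... | yes e = ⊥-elim (¬e e)
  ... | no _  = refl

  -- Starting again from `c₀` restores balance up to the one recolored vertex. The ends of `r` can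
  -- remain separate components, since `r` is now satisfied.
  restart : Request n → State n
  restart r = record
    { colors = updateAt c₀ (Request.v r) (λ _ → opposite (c₀ (Request.u r)))
    ; comp   = id
    ; moved  = 1
    ; seen   = [ r ]
    }

  -- The component of `u` is the one to be flipped; `d` is the target of a jump, should the flip
  -- exceed the allowance `b`.
  merge : Coloring n → Fin n → Fin n → State n → State n
  merge d u v s with moved s + compSize (comp s) (comp s u) ≤? b
  ... | yes _ = record s
    { colors = flip (comp s u) (comp s) (colors s)
    ; comp   = relabel (comp s u) (comp s v) (comp s)
    ; moved  = moved s + compSize (comp s) (comp s u)
    }
  ... | no _ = record s
    { colors = d
    ; comp   = relabel (comp s u) (comp s v) (comp s)
    ; moved  = 0
    }

  resolve : Coloring n → Fin n → Fin n → State n → State n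
  resolve d u v s with colors s u ≟ colors s v
  ... | no _  = s
  ... | yes _ with compSize (comp s) (comp s u) ≤? compSize (comp s) (comp s v)
  ...   | yes _ = merge d u v s
  ...   | no _  = merge d v u s

  remember : State n → Request n → State n
  remember s r = record s { seen = r ∷ seen s }

  step : State n → Request n → State n
  step s r with admissible? (r ∷ seen s)
  ... | no _        = restart r
  ... | yes (d , _) = resolve d (Request.u r) (Request.v r) (remember s r)

  start : State n
  start = record { colors = c₀ ; comp = id ; moved = 0 ; seen = [] }

  algorithm : List (Request n) → Coloring n
  algorithm = colors ∘ foldl step start

  trace : State n → List (Request n) → List (Coloring n)
  trace s []      = []
  trace s (r ∷ σ) = colors (step s r) ∷ trace (step s r) σ

  -- A run recomputes the state for every prefix. Threading the state through gives the same
  -- colorings in a form suited to induction on the requests.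
  map-inits≡trace : ∀ s σ → map (colors ∘ foldl step s) (Inits.tail σ) ≡ trace s σ
  map-inits≡trace s []      = refl
  map-inits≡trace s (r ∷ σ) = cong (colors (step s r) ∷_)
    (trans (sym (map-∘ (Inits.tail σ))) (map-inits≡trace (step s r) σ))

  record Invariant (s : State n) : Set where
    field
      balanced : ∀ i → classSize (colors s) i ≤ n / 2 + moved s
      moved≤b  : moved s ≤ b
      -- On each component, every coloring satisfying the phase is the current
      -- one or its opposite.
      aligned  : ∀ d → All (λ r → Satisfies r d) (seen s) → ∀ {x y} → comp s x ≡ comp s y →
                 agree (colors s x) (d x) ≡ agree (colors s y) (d y)

  open Invariant

  -- Correctness and amortized cost.

  module Analysis (q : ℕ) (n≤q*[1+b] : n ≤ q * suc b) (1≤b : 1 ≤ b) (balanced₀ : Respects (half n) c₀) where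

    Φ : State n → ℕ
    Φ s = suc q * potential (comp s)

    -- Each flipped vertex raises Φ by at least q + 1: 1 pays for the flip itself,
    -- and q is saved in  q * moved  for the next jump.
    Amortized : State n → State n → Set
    Amortized s s′ = distance (colors s) (colors s′) + Φ s + q * moved s′ ≤ q * moved s + Φ s′

    -- The hypothesis `separates` will hold because the violated request is already in `seen`. It
    -- mentions only the two vertices, so that either end can play the part of `u`.
    module Merge (d : Coloring n) (d-balanced : Respects (half n) d) (u v : Fin n) (s : State n)
                 (d-sat : All (λ r → Satisfies r d) (seen s))
                 (separates : ∀ d → All (λ r → Satisfies r d) (seen s) → d u ≢ d v)
                 (inv : Invariant s) (cu≡cv : colors s u ≡ colors s v)
                 (u≤v : compSize (comp s) (comp s u) ≤ compSize (comp s) (comp s v)) where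

      private
        c₁    = flip (comp s u) (comp s) (colors s)
        comp′ = relabel (comp s u) (comp s v) (comp s)
        size  = compSize (comp s) (comp s u)

      -- Within one component `d` is the current coloring or its opposite, so it would give `u` and
      -- `v` equal colors, as the current coloring does.
      u≁v : comp s u ≢ comp s v
      u≁v u∼v = separates d d-sat (agree-injective (colors s v)
        (subst (λ p → agree p (d u) ≡ agree (colors s v) (d v)) cu≡cv (aligned inv d d-sat u∼v)))

      potential-grows : potential (comp s) + size ≤ potential comp′
      potential-grows = potential-relabel (comp s) u≁v u≤v

      -- The vertices `u` and `v` share a current color but differ under `e`, so flipping the
      -- component of `u` brings it into the relation to `e` that the component of `v` already has.
      -- Alignment after the merge thus reduces to alignment before it.
      representative : ∀ e → All (λ r → Satisfies r e) (seen s) → ∀ x →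
                       ∃[ z ] comp s z ≡ comp′ x × agree (c₁ x) (e x) ≡ agree (colors s z) (e z)
      representative e e-sat x with comp s x ≟ comp s u
      ... | no _    = x , refl , refl
      ... | yes x∼u = v , refl , (begin
        agree (opposite (colors s x)) (e x)  ≡⟨ agree-opposite (colors s x) (e x) ⟩
        not (agree (colors s x) (e x))       ≡⟨ cong not (aligned inv e e-sat x∼u) ⟩
        not (agree (colors s u) (e u))       ≡⟨ not-agree (colors s u) (separates e e-sat) ⟩
        agree (colors s u) (e v)             ≡⟨ cong (λ p → agree p (e v)) cu≡cv ⟩
        agree (colors s v) (e v)             ∎)
        where open ≡-Reasoning

      aligned₁ : ∀ e → All (λ r → Satisfies r e) (seen s) → ∀ {x y} → comp′ x ≡ comp′ y →
                 agree (c₁ x) (e x) ≡ agree (c₁ y) (e y)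
      aligned₁ e e-sat {x} {y} x∼y with representative e e-sat x | representative e e-sat y
      ... | z , z∼x , ez | z′ , z′∼y , ez′ =
        trans ez (trans (aligned inv e e-sat (trans z∼x (trans x∼y (sym z′∼y)))) (sym ez′))

      unchanged : ∀ w → comp s w ≢ comp s u → c₁ w ≡ colors s w
      unchanged w = flip-∉ (comp s) (colors s)

      c₁-separates : c₁ u ≢ c₁ v
      c₁-separates c₁u≡c₁v = opposite-≢ (colors s v) (begin
        opposite (colors s v)  ≡⟨ cong opposite cu≡cv ⟨
        opposite (colors s u)  ≡⟨ flip-∈ (comp s) (colors s) refl ⟨
        c₁ u                   ≡⟨ c₁u≡c₁v ⟩
        c₁ v                   ≡⟨ unchanged v (u≁v ∘ sym) ⟩
        colors s v             ∎)
        where open ≡-Reasoning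

      merge-correct : Invariant (merge d u v s) × colors (merge d u v s) u ≢ colors (merge d u v s) v ×
                      Amortized s (merge d u v s) × seen (merge d u v s) ≡ seen s
      merge-correct with moved s + size ≤? b
      ... | yes ≤b = record
          { balanced = λ i → begin
              classSize c₁ i                       ≤⟨ classSize-within (λ w → comp s w ≟ comp s u) (colors s) c₁ unchanged i ⟩
              classSize (colors s) i + size        ≤⟨ +-monoˡ-≤ size (balanced inv i) ⟩
              n / 2 + moved s + size               ≡⟨ +-assoc (n / 2) (moved s) size ⟩
              n / 2 + (moved s + size)             ∎
          ; moved≤b  = ≤b
          ; aligned  = aligned₁
          } , c₁-separates , (begin
              distance (colors s) c₁ + Φ s + q * (moved s + size)
                ≤⟨ +-monoˡ-≤ (q * (moved s + size)) (+-monoˡ-≤ (Φ s)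
                     (distance-within (λ w → comp s w ≟ comp s u) (colors s) c₁ unchanged)) ⟩
              size + Φ s + q * (moved s + size)
                ≡⟨ solve 4 (λ z q p m → z :+ (con 1 :+ q) :* p :+ q :* (m :+ z) := q :* m :+ (con 1 :+ q) :* (p :+ z))
                     refl size q (potential (comp s)) (moved s) ⟩
              q * moved s + suc q * (potential (comp s) + size)
                ≤⟨ +-monoʳ-≤ (q * moved s) (*-monoʳ-≤ (suc q) potential-grows) ⟩
              q * moved s + suc q * potential comp′ ∎) , refl
        where
        open ≤-Reasoning
        open +-*-Solver
      ... | no ≰b = record
          { balanced = λ i → ≤-trans (d-balanced i) (m≤m+n (n / 2) 0)
          ; moved≤b  = z≤n
          -- Both `d` and `e` satisfy the phase, so `c₁` is aligned with each of them, and hence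
          -- they are aligned with each other.
          ; aligned  = λ e e-sat {x} {y} x∼y → agree-trans (c₁ x) (c₁ y) (aligned₁ d d-sat x∼y) (aligned₁ e e-sat x∼y)
          } , separates d d-sat , (begin
              distance (colors s) d + Φ s + q * 0
                ≤⟨ +-monoˡ-≤ (q * 0) (+-monoˡ-≤ (Φ s) (distance≤n (colors s) d)) ⟩
              -- The refused flip would have raised the count above `b`, so `q` times the raised
              -- count covers `n`, the most that a jump can cost.
              n + Φ s + q * 0
                ≤⟨ +-monoˡ-≤ (q * 0) (+-monoˡ-≤ (Φ s) (≤-trans n≤q*[1+b] (*-monoʳ-≤ q (≰⇒> ≰b)))) ⟩
              q * (moved s + size) + Φ s + q * 0
                -- No flip is paid for here; `size` is added so that the sum factors as in the other
                -- case.
                ≤⟨ m≤n+m _ size ⟩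
              size + (q * (moved s + size) + Φ s + q * 0)
                ≡⟨ solve 4 (λ z q p m → z :+ (q :* (m :+ z) :+ (con 1 :+ q) :* p :+ q :* con 0) := q :* m :+ (con 1 :+ q) :* (p :+ z))
                     refl size q (potential (comp s)) (moved s) ⟩
              q * moved s + suc q * (potential (comp s) + size)
                ≤⟨ +-monoʳ-≤ (q * moved s) (*-monoʳ-≤ (suc q) potential-grows) ⟩
              q * moved s + suc q * potential comp′ ∎) , refl
        where
        open ≤-Reasoning
        open +-*-Solver

    distance-self : ∀ (c : Coloring n) → distance c c ≡ 0
    distance-self c = count-none (λ w → ¬? (c w ≟ c w)) (λ w ¬e → ¬e refl) (allFin n)

    resolve-correct : ∀ d u v s → Respects (half n) d → All (λ r → Satisfies r d) (seen s) →
                      (∀ d → All (λ r → Satisfies r d) (seen s) → d u ≢ d v) → Invariant s →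
                      Invariant (resolve d u v s) × colors (resolve d u v s) u ≢ colors (resolve d u v s) v ×
                      Amortized s (resolve d u v s) × seen (resolve d u v s) ≡ seen s
    resolve-correct d u v s d-balanced d-sat separates inv with colors s u ≟ colors s v
    ... | no cu≢cv = inv , cu≢cv , ≤-reflexive
          (trans (cong (λ t → t + Φ s + q * moved s) (distance-self (colors s))) (+-comm (Φ s) (q * moved s))) , refl
    ... | yes cu≡cv with compSize (comp s) (comp s u) ≤? compSize (comp s) (comp s v)
    ...   | yes u≤v = Merge.merge-correct d d-balanced u v s d-sat separates inv cu≡cv u≤v
    ...   | no u≰v with Merge.merge-correct d d-balanced v u s d-sat (λ e e-sat → separates e e-sat ∘ sym)
                          inv (sym cu≡cv) (<⇒≤ (≰⇒> u≰v))
    ...     | inv′ , sep , rest = inv′ , sep ∘ sym , rest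

    module _ (r : Request n) where

      private
        u  = Request.u r
        v  = Request.v r
        c₁ = colors (restart r)

      restart-unchanged : ∀ w → w ≢ v → c₁ w ≡ c₀ w
      restart-unchanged w w≢v = updateAt-minimal w v c₀ w≢v

      restart-satisfies : Satisfies r c₁
      restart-satisfies c₁u≡c₁v = opposite-≢ (c₀ u) (begin
        opposite (c₀ u)  ≡⟨ updateAt-updates v c₀ ⟨
        c₁ v             ≡⟨ c₁u≡c₁v ⟨
        c₁ u             ≡⟨ restart-unchanged u (Request.distinct r) ⟩
        c₀ u             ∎)
        where open ≡-Reasoning

      restart-invariant : Invariant (restart r)
      restart-invariant = record
        { balanced = λ i → ≤-trans (classSize-within (_≟ v) c₀ c₁ restart-unchanged i)
                                   (+-mono-≤ (balanced₀ i) (count-≟-tabulate id id v))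
        ; moved≤b  = 1≤b
        -- Every component is a single vertex, so equal labels mean equal vertices.
        ; aligned  = λ { _ _ refl → refl }
        }

    start-invariant : Invariant start
    start-invariant = record
      { balanced = λ i → ≤-trans (balanced₀ i) (m≤m+n (n / 2) 0)
      ; moved≤b  = z≤n
      ; aligned  = λ { _ _ refl → refl }
      }

    -- This is what the cost argument has to know about a step, separated from the case distinctions
    -- of the algorithm.
    data Outcome (s : State n) (r : Request n) : State n → Set where
      restarted : ¬ ∃ (Admissible (r ∷ seen s)) → Outcome s r (restart r)
      continued : ∀ {s′} → seen s′ ≡ r ∷ seen s → Amortized s s′ → Outcome s r s′

    step-correct : ∀ s r → Invariant s →
                   Invariant (step s r) × Satisfies r (colors (step s r)) × Outcome s r (step s r)
    step-correct s r inv with admissible? (r ∷ seen s)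
    ... | no ¬adm = restart-invariant r , restart-satisfies r , restarted ¬adm
    ... | yes (d , d-balanced , d-sat) with resolve-correct d (Request.u r) (Request.v r) (remember s r)
            d-balanced d-sat (λ { e (e-sat ∷ _) → e-sat })
            -- Fewer colorings satisfy the longer list of requests, so alignment is preserved.
            record { balanced = balanced inv ; moved≤b = moved≤b inv ; aligned = λ { e (_ ∷ e-sat) → aligned inv e e-sat } }
    ...   | inv′ , sat , amortized , seen≡ = inv′ , sat , continued seen≡ amortized

    trace-feasible : ∀ {B : Capacity} → (∀ {m} → m ≤ n / 2 + b → B m) →
                     ∀ s σ → Invariant s → Feasible B σ (trace s σ)
    trace-feasible B≥ s []      inv = []
    trace-feasible B≥ s (r ∷ σ) inv with step-correct s r inv
    ... | inv′ , sat , _ =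
      (sat , λ i → B≥ (≤-trans (balanced inv′ i) (+-monoʳ-≤ (n / 2) (moved≤b inv′)))) ∷
      trace-feasible B≥ (step s r) σ inv′

    -- `N` stands for `n * ⌊log₂ n ⌋`.
    module _ (N : ℕ) (1≤N : 1 ≤ N) (n≤N : n ≤ N) (potential≤N : ∀ comp → potential {n} comp ≤ N) where

      -- A restart pays `N` for the recoloring, at most `q * N` for its initial credit, and
      -- `suc q * N` each for the discarded potential and the allowance of the new phase. One
      -- `suc q * N` is already in the bound; the rest is `Z`.
      Z : ℕ
      Z = (2 + (q + q)) * N

      -- d is the current offline coloring and β the offline cost in this phase so
      -- far; while β = 0, d satisfies all requests of the phase.
      trace-cost : ∀ s σ → Invariant s → ∀ d cs → Feasible (half n) σ cs →
                   ∀ β → 0 < β ⊎ All (λ r → Satisfies r d) (seen s) →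
                   cost (colors s) (trace s σ) + Φ s ≤ q * moved s + suc q * N + Z * (β + cost d cs)
      trace-cost s [] inv d [] [] β _ =
        ≤-trans (*-monoʳ-≤ (suc q) (potential≤N (comp s)))
                (≤-trans (m≤n+m _ (q * moved s)) (m≤m+n _ _))
      trace-cost s (r ∷ σ) inv d (d′ ∷ cs) ((r-sat , d′-balanced) ∷ feas) β current
        with step s r | step-correct s r inv
      ... | s′ | inv′ , _ , continued seen≡ amortized = begin
          distance (colors s) (colors s′) + cost (colors s′) (trace s′ σ) + Φ s
            ≤⟨ telescope {distance (colors s) (colors s′)} {cost (colors s′) (trace s′ σ)}
                 {Φ s} {Φ s′} {q * moved s} {q * moved s′} amortized
                 (trace-cost s′ σ inv′ d′ cs feas (β + distance d d′) (current′ current)) ⟩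
          q * moved s + suc q * N + Z * (β + distance d d′ + cost d′ cs)
            ≡⟨ cong (λ t → q * moved s + suc q * N + Z * t) (+-assoc β (distance d d′) (cost d′ cs)) ⟩
          q * moved s + suc q * N + Z * (β + (distance d d′ + cost d′ cs)) ∎
        where
        open ≤-Reasoning
        current′ : 0 < β ⊎ All (λ r → Satisfies r d) (seen s) →
                   0 < β + distance d d′ ⊎ All (λ r → Satisfies r d′) (seen s′)
        current′ (inj₁ 0<β) = inj₁ (≤-trans 0<β (m≤m+n β _))
        current′ (inj₂ d-sat) with 0<distance⊎≗ d d′
        ... | inj₁ 0<dist = inj₁ (≤-trans 0<dist (m≤n+m _ β))
        ... | inj₂ d′≗d   = inj₂ (subst (All _) (sym seen≡) (r-sat ∷ All.map (λ {r} → Satisfies-resp d′≗d {r}) d-sat))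
      ... | s′ | inv′ , _ , restarted ¬adm = begin
          distance (colors s) (colors s′) + cost (colors s′) (trace s′ σ) + Φ s
            ≤⟨ +-mono-≤ (+-mono-≤ (≤-trans (distance≤n (colors s) (colors s′)) n≤N) (m+n≤o⇒m≤o _ ih))
                        (*-monoʳ-≤ (suc q) (potential≤N (comp s))) ⟩
          N + (q * 1 + suc q * N + Z * cost d′ cs) + suc q * N
            ≤⟨ +-monoˡ-≤ (suc q * N) (+-monoʳ-≤ N (+-monoˡ-≤ (Z * cost d′ cs) (+-monoˡ-≤ (suc q * N) (*-monoʳ-≤ q 1≤N)))) ⟩
          N + (q * N + suc q * N + Z * cost d′ cs) + suc q * N
            ≡⟨ solve 3 (λ q N k → N :+ (q :* N :+ (con 1 :+ q) :* N :+ (con 2 :+ (q :+ q)) :* N :* k) :+ (con 1 :+ q) :* N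
                               := (con 1 :+ q) :* N :+ (con 2 :+ (q :+ q)) :* N :* (con 1 :+ k)) refl q N (cost d′ cs) ⟩
          suc q * N + Z * (1 + cost d′ cs)
            ≤⟨ +-mono-≤ (m≤n+m _ (q * moved s)) (*-monoʳ-≤ Z (+-monoˡ-≤ (cost d′ cs) (opt-pays current))) ⟩
          q * moved s + suc q * N + Z * (β + distance d d′ + cost d′ cs)
            ≡⟨ cong (λ t → q * moved s + suc q * N + Z * t) (+-assoc β (distance d d′) (cost d′ cs)) ⟩
          q * moved s + suc q * N + Z * (β + (distance d d′ + cost d′ cs)) ∎
        where
        open ≤-Reasoning
        open +-*-Solver
        -- The new phase starts with offline cost zero, and `d′` satisfies its only request.
        ih = trace-cost s′ σ inv′ d′ cs feas 0 (inj₂ (r-sat ∷ []))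
        opt-pays : 0 < β ⊎ All (λ r → Satisfies r d) (seen s) → 1 ≤ β + distance d d′
        opt-pays (inj₁ 0<β) = ≤-trans 0<β (m≤m+n β _)
        opt-pays (inj₂ d-sat) with 0<distance⊎≗ d d′
        ... | inj₁ 0<dist = ≤-trans 0<dist (m≤n+m _ β)
        -- An offline coloring that stayed put would be balanced and satisfy the whole phase
        -- together with `r`, contrary to `¬adm`.
        ... | inj₂ d′≗d   = ⊥-elim (¬adm (d′ , d′-balanced , r-sat ∷ All.map (λ {r} → Satisfies-resp d′≗d {r}) d-sat))

-- From the real `ε` to natural numbers.

L-down : ∀ (ε : ℝ) {q r} → q ℚ.≤ r → L ε r → L ε q
L-down ε {q} {r} q≤r Lr with ℚ.<-cmp q r
... | tri< q<r _ _ = Equivalence.from (ℝ.L-rounded ε q) (r , q<r , Lr)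
... | tri≈ _ refl _ = Lr
... | tri> _ _ r<q = ⊥-elim (ℚ.<-irrefl refl (ℚ.<-≤-trans r<q q≤r))

L<U : ∀ (ε : ℝ) {q r} → L ε q → U ε r → q ℚ.< r
L<U ε {q} {r} Lq Ur = ℚ.≰⇒> λ r≤q → ℝ.disjoint ε r (L-down ε r≤q Lq) Ur

-- Roundedness gives a positive rational below `ε`. Its numerator is at least one, so the reciprocal
-- of its denominator is no larger.
positive⇒1/[1+k]-below : ∀ (ε : ℝ) → L ε 0ℚ → ∃[ k ] L ε (+ 1 ℚ./ suc k)
positive⇒1/[1+k]-below ε L0 with Equivalence.to (ℝ.L-rounded ε 0ℚ) L0
... | mkℚ (+ zero) d _ , ℚ.*<* 0<r , Lr = ⊥-elim (ℤ.<-irrefl refl 0<r)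
... | mkℚ -[1+ a ] d _ , ℚ.*<* () , Lr
... | r@(mkℚ (+ suc a) d _) , _ , Lr = d , L-down ε (ℚ.toℚᵘ-cancel-≤ (begin
    ℚ.toℚᵘ (+ 1 ℚ./ suc d)  ≃⟨ ℚ.toℚᵘ-fromℚᵘ (ℚᵘ.mkℚᵘ (+ 1) d) ⟩
    ℚᵘ.mkℚᵘ (+ 1) d         ≤⟨ ℚᵘ.*≤* (ℤ.*-monoʳ-≤-nonNeg (+ suc d) (ℤ.+≤+ {1} {suc a} (s≤s z≤n))) ⟩
    ℚ.toℚᵘ r                ∎)) Lr
  where open ℚᵘ.≤-Reasoning

-- With `p / e` a rational above `ε`, `h` and `g` are `n / 2` and `n / (4 * k)` rounded down. Both
-- `g` and the extra one are at most a quarter of `n * p / e`, the former because `1 / k ≤ p / e`.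
-- Together they fit into the augmentation, which is half of it.
nat-slack : ∀ {n k m g h p e} → 1 * e ≤ p * k → 8 * e ≤ n * p → g * (4 * k) ≤ n → h * 2 ≤ n →
        m ≤ h + suc g → m * (e * 2) ≤ (e + p) * n
nat-slack {n} {k} {m} {g} {h} {p} {e} e≤pk 8e≤np 4gk≤n 2h≤n m≤ = *-cancelˡ-≤ 2 (begin
  2 * (m * (e * 2))                           ≤⟨ *-monoʳ-≤ 2 (*-monoˡ-≤ (e * 2) m≤) ⟩
  2 * ((h + suc g) * (e * 2))                 ≡⟨ eq₁ ⟩
  2 * e * (h * 2) + 4 * e + 4 * g * (1 * e)   ≤⟨ +-mono-≤ (+-mono-≤ (*-monoʳ-≤ (2 * e) 2h≤n) 4e≤np)
                                                   (*-monoʳ-≤ (4 * g) e≤pk) ⟩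
  2 * e * n + n * p + 4 * g * (p * k)         ≡⟨ eq₂ ⟩
  2 * e * n + n * p + g * (4 * k) * p         ≤⟨ +-monoʳ-≤ (2 * e * n + n * p) (*-monoˡ-≤ p 4gk≤n) ⟩
  2 * e * n + n * p + n * p                   ≡⟨ eq₃ ⟩
  2 * ((e + p) * n)                           ∎)
  where
  open ≤-Reasoning
  open +-*-Solver
  4e≤np = ≤-trans (*-monoˡ-≤ e (m≤m+n 4 4)) 8e≤np
  eq₁ = solve 3 (λ e h g → con 2 :* ((h :+ (con 1 :+ g)) :* (e :* con 2)) :=
                 con 2 :* e :* (h :* con 2) :+ con 4 :* e :+ con 4 :* g :* (con 1 :* e)) refl e h g
  eq₂ = solve 5 (λ e n p g k → con 2 :* e :* n :+ n :* p :+ con 4 :* g :* (p :* k) :=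
                 con 2 :* e :* n :+ n :* p :+ g :* (con 4 :* k) :* p) refl e n p g k
  eq₃ = solve 3 (λ e n p → con 2 :* e :* n :+ n :* p :+ n :* p := con 2 :* ((e :+ p) :* n)) refl e n p

pos-*-cancel-≤ : ∀ {a b c d} → + a ℤ.* + b ℤ.≤ + c ℤ.* + d → a * b ≤ c * d
pos-*-cancel-≤ {a} {b} {c} {d} le = ℤ.drop‿+≤+ (subst₂ ℤ._≤_ (sym (ℤ.pos-* a b)) (sym (ℤ.pos-* c d)) le)

-- The 1 in suc (n / (4 * suc k)) allows the single flip at the start of a phase,
-- and is at most εn/4 because n ≥ 8/ε.
augmented-slack : ∀ (ε : ℝ) {k n m} → L ε (+ 1 ℚ./ suc k) → n ≥8/ ε →
                  m ≤ n / 2 + suc (n / (4 * suc k)) → augmented ε n m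
augmented-slack ε {k} {n} {m} L1/k n≥8/ε m≤ x Ux with L<U ε L1/k Ux | n≥8/ε x Ux
... | 1/k<x | 8≤nx = from-fraction x (ℚᵘ.≤-respˡ-≃ (ℚ.toℚᵘ-fromℚᵘ (ℚᵘ.mkℚᵘ (+ 1) k)) (ℚᵘ.<⇒≤ (ℚ.toℚᵘ-mono-< 1/k<x)))
   (ℚᵘ.≤-respʳ-≃ (ℚᵘ.≃-trans (ℚ.toℚᵘ-homo-* (fromℕ n) x) (ℚᵘ.*-congʳ (ℚ.toℚᵘ-fromℚᵘ (ℚᵘ.mkℚᵘ (+ n) 0))))
     (ℚᵘ.≤-respˡ-≃ (ℚ.toℚᵘ-fromℚᵘ (ℚᵘ.mkℚᵘ (+ 8) 0)) (ℚ.toℚᵘ-mono-≤ 8≤nx)))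
  where
  -- Matching on unnormalised inequalities exposes their cross-multiplied integer forms, which are
  -- what `nat-slack` works with.
  from-fraction : ∀ x → ℚᵘ.mkℚᵘ (+ 1) k ℚᵘ.≤ ℚ.toℚᵘ x →
                  ℚᵘ.mkℚᵘ (+ 8) 0 ℚᵘ.≤ ℚᵘ.mkℚᵘ (+ n) 0 ℚᵘ.* ℚ.toℚᵘ x →
                  fromℕ m ℚ.≤ (1ℚ ℚ.+ x) ℚ.* (+ n ℚ./ 2)
  from-fraction (mkℚ -[1+ p ] e _) (ℚᵘ.*≤* ()) _
  from-fraction x@(mkℚ (+ p) e _) (ℚᵘ.*≤* e≤pk) (ℚᵘ.*≤* 8e≤np) = ℚ.toℚᵘ-cancel-≤ (begin
    ℚ.toℚᵘ (fromℕ m)                                        ≃⟨ ℚ.toℚᵘ-fromℚᵘ (ℚᵘ.mkℚᵘ (+ m) 0) ⟩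
    ℚᵘ.mkℚᵘ (+ m) 0                                         ≤⟨ ℚᵘ.*≤* core ⟩
    (ℚᵘ.1ℚᵘ ℚᵘ.+ ℚ.toℚᵘ x) ℚᵘ.* ℚᵘ.mkℚᵘ (+ n) 1             ≃⟨ ℚᵘ.*-cong (ℚ.toℚᵘ-homo-+ 1ℚ x) (ℚ.toℚᵘ-fromℚᵘ (ℚᵘ.mkℚᵘ (+ n) 1)) ⟨
    ℚ.toℚᵘ (1ℚ ℚ.+ x) ℚᵘ.* ℚ.toℚᵘ (+ n ℚ./ 2)               ≃⟨ ℚ.toℚᵘ-homo-* (1ℚ ℚ.+ x) (+ n ℚ./ 2) ⟨
    ℚ.toℚᵘ ((1ℚ ℚ.+ x) ℚ.* (+ n ℚ./ 2))                     ∎)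
    where
    open ℚᵘ.≤-Reasoning
    8e≤np′ : 8 * suc e ≤ n * p
    8e≤np′ = ℤ.drop‿+≤+ (subst₂ ℤ._≤_ (cong (λ z → + (8 * suc z)) (+-identityʳ e))
                         (trans (ℤ.*-identityʳ (+ n ℤ.* + p)) (sym (ℤ.pos-* n p))) 8e≤np)
    nat : m * (suc e * 2) ≤ (suc e + p) * n
    nat = nat-slack {k = suc k} {g = n / (4 * suc k)} (pos-*-cancel-≤ {1} {suc e} {p} {suc k} e≤pk) 8e≤np′
            (m/n*n≤m n (4 * suc k)) (m/n*n≤m n 2) m≤
    core : + m ℤ.* + (suc (e + 0) * 2) ℤ.≤ (+ 1 ℤ.* + suc e ℤ.+ + p ℤ.* + 1) ℤ.* + n ℤ.* + 1
    core = subst₂ ℤ._≤_ (trans (ℤ.pos-* m (suc e * 2)) (cong (λ z → + m ℤ.* + (suc z * 2)) (sym (+-identityʳ e))))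
             (trans (ℤ.pos-* (suc e + p) n)
               (trans (cong (ℤ._* + n) (cong₂ ℤ._+_ (sym (ℤ.*-identityˡ (+ suc e))) (sym (ℤ.*-identityʳ (+ p)))))
                 (sym (ℤ.*-identityʳ _))))
             (ℤ.+≤+ nat)

-- The hypothesis on `n` is evaluated at the upper bound 1 of `ε`. This makes the logarithm of `n`
-- at least one.
ε<1⇒8≤n : ∀ (ε : ℝ) {n} → U ε 1ℚ → n ≥8/ ε → 8 ≤ n
ε<1⇒8≤n ε {n} U1 n≥8/ε with ℚᵘ.≤-respˡ-≃ (ℚ.toℚᵘ-fromℚᵘ (ℚᵘ.mkℚᵘ (+ 8) 0))
  (ℚᵘ.≤-respʳ-≃ (ℚ.toℚᵘ-fromℚᵘ (ℚᵘ.mkℚᵘ (+ n) 0))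
    (ℚ.toℚᵘ-mono-≤ (subst (fromℕ 8 ℚ.≤_) (ℚ.*-identityʳ (fromℕ n)) (n≥8/ε 1ℚ U1))))
... | ℚᵘ.*≤* 8≤n = ℤ.drop‿+≤+ (subst (+ 8 ℤ.≤_) (ℤ.*-identityʳ (+ n)) 8≤n)

-- This is the condition that the flips before a jump pay for it, with `1 + b` equal to two more
-- than the quotient.
n≤q*[2+n/q] : ∀ n q → n ≤ suc q * (2 + n / suc q)
n≤q*[2+n/q] n q = begin
  n                                        ≡⟨ m≡m%n+[m/n]*n n (suc q) ⟩
  _ + n / suc q * suc q                    ≤⟨ +-monoˡ-≤ _ (<⇒≤ (m%n<n n (suc q))) ⟩
  (1 + n / suc q) * suc q                  ≤⟨ *-monoˡ-≤ (suc q) (n≤1+n (1 + n / suc q)) ⟩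
  (2 + n / suc q) * suc q                  ≡⟨ *-comm (2 + n / suc q) (suc q) ⟩
  suc q * (2 + n / suc q)                  ∎
  where open ≤-Reasoning

-- Choice of the constants.

theorem1 : ∀ (ε : ℝ) → InUnitInterval ε →
    Σ[ K ∈ ℕ ]
    (∀ (n : ℕ) → 2 ∣ n → n ≥8/ ε →
    Σ[ A ∈ OnlineAlgorithm n ] Σ[ μ ∈ ℕ ]
    (∀ (c₀ : Coloring n) → Respects (half n) c₀ →
    ∀ (σ : List (Request n)) →
    Feasible (augmented ε n) σ (run A c₀ σ) ×
    (∀ (opt : ℕ) → IsOPT (half n) c₀ σ opt →
    cost c₀ (run A c₀ σ) ≤ K * (n * ⌊log₂ n ⌋) * opt + μ)))
theorem1 ε (L0 , U1) with positive⇒1/[1+k]-below ε L0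
-- `K` is `Z` without its factor `N`; it depends on `ε` through `k` alone.
... | k , L1/k = 2 + (q + q) , λ n _ n≥8/ε →
  -- The quotient is at most `ε n / 4`; the added one leaves room for the flip that a restart
  -- counts.
  let b = suc (n / q)
      N = n * ⌊log₂ n ⌋
      8≤n = ε<1⇒8≤n ε U1 n≥8/ε
      1≤log = ⌊log₂⌋-mono-≤ {2} {n} (≤-trans (m≤m+n 2 6) 8≤n)
      n≤N = ≤-trans (≤-reflexive (sym (*-identityʳ n))) (*-monoʳ-≤ n 1≤log)
      1≤N = ≤-trans (≤-trans (m≤m+n 1 7) 8≤n) n≤N
  -- The additive term covers the last phase, during which the offline algorithm may pay nothing.
  in Algorithm.algorithm b , suc q * N , λ c₀ balanced₀ σ →
  let open Algorithm b c₀
      -- `k + 3 * suc k` is the predecessor of `q`.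
      open Analysis q (n≤q*[2+n/q] n (k + 3 * suc k)) (s≤s z≤n) balanced₀
      run≡trace = map-inits≡trace start σ
  in subst (Feasible (augmented ε n) σ) (sym run≡trace)
       (trace-feasible (augmented-slack ε {k} {n} L1/k n≥8/ε) start σ start-invariant) ,
     λ { _ ((cs , feas , refl) , _) →
           let Z*opt = (2 + (q + q)) * N * cost c₀ cs in
           subst (λ ds → cost c₀ ds ≤ Z*opt + suc q * N) (sym run≡trace)
             (≤-trans (m+n≤o⇒m≤o _ (trace-cost N 1≤N n≤N potential-≤ start σ start-invariant
                                     c₀ cs feas 0 (inj₂ [])))
               (≤-reflexive (trans (cong (λ t → t + suc q * N + Z*opt) (*-zeroʳ q))
                 (+-comm (suc q * N) Z*opt)))) }
  where
  q = 4 * suc k
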